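{- Let $(W,S)$ be a finite Coxeter system and let $A\subseteq T$. Suppose there exist two subsets $S_1,S_2\subseteq S$ such that $A=S_1\cup\bigl(\bigcup_{s\in S_2}C(s)\bigr)$, where $C(s)$ denotes the conjugacy class of $s$ in $W$. Then $\mathcal{D}_A(W)$ is a subalgebra of $\mathbb{Z}W$.
   Context: $\ell:W\to\mathbb{N}$ is the length function of $(W,S)$ and $T=\{wsw^{ -1}\mid w\in W,\ s\in S\}$ is the set of reflections. For $A\subseteq T$ and $w\in W$, the $A$-descent set is $D_A(w)=\{r\in A\mid \ell(wr)<\ell(w)\}$. A subset $I\subseteq A$ is $A$-admissible if $I=D_A(w)$ for some $w\in W$; $\mathcal{P}_{\mathrm{ad}}(A)$ is the set of $A$-admissible subsets. For $I\in\mathcal{P}_{\mathrm{ad}}(A)$ put $D_I^A=\{w\in W\mid D_A(w)=I\}$ and $d_I^A=\sum_{w\in D_I^A}w\in\mathbb{Z}W$. Then $\mathcal{D}_A(W)=\bigoplus_{I\in\mathcal{P}_{\mathrm{ad}}(A)}\mathbb{Z}d_I^A$, a $\mathbb{Z}$-submodule of the group ring $\mathbb{Z}W$. A subalgebra here need not contain $1$. -}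

module Defs where

open import Level using (0ℓ)
open import Data.Nat using (ℕ; zero; suc; _<_; _<ᵇ_)
open import Data.Bool using (Bool; true; false; if_then_else_; _∧_; T)
open import Data.Bool.Properties using () renaming (_≟_ to _≟ᵇ_)
open import Data.Integer using (ℤ; 0ℤ; 1ℤ) renaming (_+_ to _+ℤ_; _*_ to _*ℤ_)
open import Data.List using (List; []; _∷_; foldr; map; concatMap; length)
open import Data.Bool.ListAction using (all; any)
open import Data.List.Membership.Propositional using (_∈_)
open import Data.List.Relation.Unary.All using (All)
open import Data.List.Relation.Unary.Unique.Propositional using (Unique)
open import Data.Product using (Σ; ∃; ∃-syntax; _×_)
open import Data.Sum using (_⊎_)
open import Relation.Nullary using (¬_)
open import Relation.Nullary.Decidable using (⌊_⌋)
open import Relation.Binary.PropositionalEquality using (_≡_; _≢_)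
open import Relation.Binary.Definitions using (DecidableEquality)
open import Algebra.Structures using (IsGroup)
open import Algebra.Bundles using (Group)
open import Algebra.Bundles.Raw using (RawGroup)
open import Algebra.Morphism.Structures using (module GroupMorphisms)

pow : {A : Set} → (A → A → A) → A → A → ℕ → A
pow _·_ e x zero    = e
pow _·_ e x (suc n) = x · pow _·_ e x n

IsOrder : {A : Set} → (A → A → A) → A → A → ℕ → Set
IsOrder _·_ e x m =
  (0 < m) × (pow _·_ e x m ≡ e) × (∀ k → 0 < k → k < m → pow _·_ e x k ≢ e)

-- A finite Coxeter system (W,S) (Bourbaki's definition): W a finite group,
-- S a set of generators of order 2, and W has the presentation
-- < S | (st)^{m(s,t)} = 1 >, m(s,t) the order of st, expressed by the
-- universal property of the presentation.
record FiniteCoxeterSystem : Set₁ where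
  field
    W        : Set
    _·_      : W → W → W
    e        : W
    _⁻¹      : W → W
    isGroup  : IsGroup _≡_ _·_ e _⁻¹
    _≟_      : DecidableEquality W
    elems          : List W
    elems-unique   : Unique elems
    elems-complete : ∀ w → w ∈ elems
    S        : List W
    S-unique : Unique S
    S-order2 : ∀ {s} → s ∈ S → (s ≢ e) × (s · s ≡ e)
    S-generates : ∀ w → ∃[ ws ] (All (_∈ S) ws × foldr _·_ e ws ≡ w)
    presentation :
      (G : Group 0ℓ 0ℓ) (f : W → Group.Carrier G) →
      (∀ {s t} → s ∈ S → t ∈ S → ∀ m → IsOrder _·_ e (s · t) m →
         Group._≈_ G (pow (Group._∙_ G) (Group.ε G) (Group._∙_ G (f s) (f t)) m) (Group.ε G)) →
      ∃[ φ ] (GroupMorphisms.IsGroupHomomorphism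
                 (record { Carrier = W ; _≈_ = _≡_ ; _∙_ = _·_ ; ε = e ; _⁻¹ = _⁻¹ })
                 (Group.rawGroup G) φ
              × (∀ {s} → s ∈ S → Group._≈_ G (φ s) (f s)))

module Coxeter (C : FiniteCoxeterSystem) where
  open FiniteCoxeterSystem C

  prod : List W → W
  prod = foldr _·_ e

  words : ℕ → List (List W)
  words zero    = [] ∷ []
  words (suc n) = concatMap (λ s → map (s ∷_) (words n)) S

  hasWordOfLength : W → ℕ → Bool
  hasWordOfLength w n = any (λ ws → ⌊ prod ws ≟ w ⌋) (words n)

  search : W → ℕ → ℕ → ℕ
  search w k zero       = k
  search w k (suc fuel) = if hasWordOfLength w k then k else search w (suc k) fuel

  -- length function ℓ(w) = minimal length of an expression of w in S.
  -- (Every w has a reduced word of length < |W|, so the search with fuel |W|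
  -- always finds the minimum.)
  ℓ : W → ℕ
  ℓ w = search w 0 (length elems)

  IsReflection : W → Set
  IsReflection r = ∃[ w ] ∃[ s ] (s ∈ S × r ≡ (w · s) · (w ⁻¹))

  InConjClass : W → W → Set
  InConjClass s r = ∃[ w ] (r ≡ (w · s) · (w ⁻¹))

  descent : (W → Bool) → W → W → Bool
  descent A w r = A r ∧ (ℓ (w · r) <ᵇ ℓ w)

  sameDescent : (W → Bool) → W → W → Bool
  sameDescent A v w = all (λ r → ⌊ descent A v r ≟ᵇ descent A w r ⌋) elems

  -- group ring ℤW: functions W → ℤ (W is finite)
  ℤW : Set
  ℤW = W → ℤ

  Σ[w∈W] : (W → ℤ) → ℤ
  Σ[w∈W] f = foldr (λ a acc → f a +ℤ acc) 0ℤ elems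

  _*W_ : ℤW → ℤW → ℤW
  (x *W y) v = Σ[w∈W] (λ a → x a *ℤ y ((a ⁻¹) · v))

  -- d_I^A for I = D_A(w) (every A-admissible I is of this form):
  -- the sum of all v with D_A(v) = D_A(w)
  d : (W → Bool) → W → ℤW
  d A w v = if sameDescent A v w then 1ℤ else 0ℤ

  -- x ∈ 𝒟_A(W) = ℤ-span of { d_I^A | I admissible } = span of { d(D_A(w)) | w ∈ W }
  In𝒟 : (W → Bool) → ℤW → Set
  In𝒟 A x = Σ (W → ℤ) λ c → (∀ v → x v ≡ Σ[w∈W] (λ w → c w *ℤ d A w v))

-- For a reflection r the parity η w r of the number of occurrences of r among the
-- inversions of a word for w is well defined, by the presentation, and decides
-- whether ℓ (w r) < ℓ w. The cocycle identity η (a b) r = η a (b r b⁻¹) + η b r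
-- shows that left multiplication by s changes η v only at v⁻¹ s v. So the classes
-- of equal A-descent set are exactly the components of the graph with edges
-- v — s v, v⁻¹ s v ∉ A, and 𝒟_A(W) consists of the functions constant along edges.
-- Given such an edge and v = a b, put r = a⁻¹ s a. If r ∉ A then s v = (s a) b with
-- a — s a an edge. If r ∈ A then r ∈ S, since otherwise the conjugate
-- v⁻¹ s v = b⁻¹ r b would lie in A; so s v = a (r b) with b — r b an edge. This
-- bijection between factorisations of v and of s v gives (x y)(v) = (x y)(s v).
module Submission where

open import Level using (0ℓ)
open import Defs
open import Algebra.Bundles using (Group)
import Algebra.Properties.Group as GroupProperties
open import Algebra.Morphism.Structures using (module GroupMorphisms)
open import Data.Bool using (Bool; true; false; if_then_else_; _∧_; _xor_; T)
open import Data.Bool.Properties using (T-≡; xor-assoc; xor-same; xor-identityʳ; ⇔→≡) renaming (_≟_ to _≟ᵇ_)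
open import Data.Fin using (Fin; toℕ)
open import Data.Fin.Properties using (pigeonhole; toℕ<n)
open import Data.Integer using (ℤ; 0ℤ; 1ℤ) renaming (_+_ to _+ℤ_; _*_ to _*ℤ_)
import Data.Integer.Properties as ℤₚ
open import Data.List using (List; []; _∷_; foldr; map; length; lookup; take; drop; _++_)
open import Data.List.Properties using (foldr-map; length-++; length-drop; take++drop≡id)
open import Data.List.Membership.Propositional using (_∈_; lose; find)
open import Data.List.Membership.Propositional.Properties using (∈-map⁺; ∈-map⁻; ∈-concatMap⁺; ∈-concatMap⁻)
open import Data.List.Membership.Propositional.Properties.WithK using (unique∧set⇒bag)
open import Data.List.Relation.Binary.BagAndSetEquality using (∼bag⇒↭)
open import Data.List.Relation.Binary.Permutation.Propositional using (_↭_; ↭⇒↭ₛ)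
import Data.List.Relation.Binary.Permutation.Propositional.Properties as ↭
import Data.List.Relation.Binary.Permutation.Setoid.Properties as ↭ₛ
open import Data.List.Relation.Unary.All as All using (All; []; _∷_)
import Data.List.Relation.Unary.All.Properties as All
open import Data.List.Relation.Unary.AllPairs using (_∷_)
open import Data.List.Relation.Unary.Any as Any using (here; there)
import Data.List.Relation.Unary.Any.Properties as Any
open import Data.List.Relation.Unary.Unique.Propositional using (Unique)
import Data.List.Relation.Unary.Unique.Propositional.Properties as Unique
open import Data.Nat using (ℕ; zero; suc; _+_; _≤_; _<_; z≤n; s≤s; s≤s⁻¹; _<ᵇ_; _≤?_)
open import Data.Nat.Properties using (+-suc; +-identityʳ; +-monoʳ-<; ∸-monoʳ-<;
  ≤-refl; ≤-trans; ≤-reflexive; ≤-antisym; <⇒≤; n≤1+n;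
  <⇒≱; <-asym; ≤∧≢⇒<; ≰⇒>; <ᵇ⇒<; <⇒<ᵇ)
open import Data.Product using (∃-syntax; _×_; _,_; proj₁; proj₂)
open import Data.Sum using (_⊎_; inj₁; inj₂)
open import Function.Bundles using (_⇔_; mk⇔; Equivalence)
open import Relation.Binary.PropositionalEquality
open import Relation.Nullary using (¬_; yes; no; contradiction)
open import Relation.Nullary.Decidable using (⌊_⌋; toWitness; fromWitness; isYes≗does; does-⇔)

private
  variable
    X : Set

-- Finite integer sums and searching a list.

sumOver : List X → (X → ℤ) → ℤ
sumOver xs f = foldr (λ a acc → f a +ℤ acc) 0ℤ xs

sum-cong : ∀ (xs : List X) {f g} → (∀ a → f a ≡ g a) → sumOver xs f ≡ sumOver xs g
sum-cong []       eq = refl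
sum-cong (a ∷ xs) eq = cong₂ _+ℤ_ (eq a) (sum-cong xs eq)

sum-zero : ∀ (xs : List X) {f} → All (λ a → f a ≡ 0ℤ) xs → sumOver xs f ≡ 0ℤ
sum-zero []       []         = refl
sum-zero (a ∷ xs) (fa ∷ fxs) = cong₂ _+ℤ_ fa (sum-zero xs fxs)

sum-single : ∀ {xs : List X} {f b} → Unique xs → b ∈ xs → (∀ a → a ≢ b → f a ≡ 0ℤ) → sumOver xs f ≡ f b
sum-single {f = f} (b∉ ∷ _) (here refl) zero-off = trans
  (cong (f _ +ℤ_) (sum-zero _ (All.map (λ b≢a → zero-off _ (λ a≡b → b≢a (sym a≡b))) b∉)))
  (ℤₚ.+-identityʳ _)
sum-single (a∉ ∷ unique) (there b∈) zero-off = trans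
  (cong₂ _+ℤ_ (zero-off _ (All.lookup a∉ b∈)) (sum-single unique b∈ zero-off))
  (ℤₚ.+-identityˡ _)

sum-↭ : ∀ {xs ys : List X} (f : X → ℤ) → xs ↭ ys → sumOver xs f ≡ sumOver ys f
sum-↭ {xs = xs} {ys} f xs↭ys = trans (sym (foldr-map _+ℤ_ f 0ℤ xs)) (trans
  (↭ₛ.foldr-commMonoid (setoid ℤ) ℤₚ.+-0-isCommutativeMonoid (↭⇒↭ₛ (↭.map⁺ f xs↭ys)))
  (foldr-map _+ℤ_ f 0ℤ ys))

-- The result depends on `p` only through its values, so equivalent elements with the same test
-- select the same representative of their class.
first : (X → Bool) → X → List X → X
first p default []       = default
first p default (a ∷ xs) = if p a then a else first p default xs

first-satisfies : ∀ (p : X → Bool) {default xs a} → a ∈ xs → p a ≡ true → p (first p default xs) ≡ true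
first-satisfies p {xs = b ∷ _} a∈ pa with p b in pb
... | true = pb
first-satisfies p (here refl) pa | false = contradiction (trans (sym pb) pa) λ ()
first-satisfies p (there a∈)  pa | false = first-satisfies p a∈ pa

first-cong : ∀ {p q : X → Bool} {default} → (∀ a → p a ≡ q a) → ∀ xs → first p default xs ≡ first q default xs
first-cong eq []       = refl
first-cong eq (a ∷ xs) = cong₂ (λ b c → if b then a else c) (eq a) (first-cong eq xs)

module DescentClasses (C : FiniteCoxeterSystem) where
  open FiniteCoxeterSystem C
  open Coxeter C

  group : Group 0ℓ 0ℓ
  group = record { isGroup = isGroup }

  open Group group using (assoc; identityˡ; identityʳ; inverseˡ; inverseʳ)
  open GroupProperties group
  open ≡-Reasoning

  -- Conjugation, powers and simple reflections.

  conj : W → W → W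
  conj a r = (a · r) · (a ⁻¹)

  conj-· : ∀ a b r → conj (a · b) r ≡ conj a (conj b r)
  conj-· a b r = begin
    ((a · b) · r) · ((a · b) ⁻¹)         ≡⟨ cong₂ _·_ (assoc a b r) (⁻¹-anti-homo-∙ a b) ⟩
    (a · (b · r)) · ((b ⁻¹) · (a ⁻¹))    ≡⟨ assoc _ _ _ ⟨
    ((a · (b · r)) · (b ⁻¹)) · (a ⁻¹)    ≡⟨ cong (_· (a ⁻¹)) (assoc a (b · r) (b ⁻¹)) ⟩
    (a · ((b · r) · (b ⁻¹))) · (a ⁻¹)    ∎

  conj-e : ∀ r → conj e r ≡ r
  conj-e r = trans (cong₂ _·_ (identityˡ r) ε⁻¹≈ε) (identityʳ r)

  conj-swap : ∀ a r → conj a r · a ≡ a · r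
  conj-swap a r = //-rightDividesˡ a (a · r)

  conj-homo : ∀ a r s → conj a (r · s) ≡ conj a r · conj a s
  conj-homo a r s = sym (begin
    conj a r · ((a · s) · (a ⁻¹))    ≡⟨ assoc _ _ _ ⟨
    (conj a r · (a · s)) · (a ⁻¹)    ≡⟨ cong (_· (a ⁻¹)) (assoc _ _ _) ⟨
    ((conj a r · a) · s) · (a ⁻¹)    ≡⟨ cong (λ z → (z · s) · (a ⁻¹)) (conj-swap a r) ⟩
    ((a · r) · s) · (a ⁻¹)           ≡⟨ cong (_· (a ⁻¹)) (assoc a r s) ⟩
    conj a (r · s)                   ∎)

  conj-fixes-e : ∀ a → conj a e ≡ e
  conj-fixes-e a = trans (cong (_· (a ⁻¹)) (identityʳ a)) (inverseʳ a)

  conj-⁻¹ˡ : ∀ a r → conj (a ⁻¹) (conj a r) ≡ r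
  conj-⁻¹ˡ a r = begin
    conj (a ⁻¹) (conj a r)  ≡⟨ conj-· (a ⁻¹) a r ⟨
    conj ((a ⁻¹) · a) r     ≡⟨ cong (λ b → conj b r) (inverseˡ a) ⟩
    conj e r                ≡⟨ conj-e r ⟩
    r                       ∎

  conj-⁻¹ʳ : ∀ a r → conj a (conj (a ⁻¹) r) ≡ r
  conj-⁻¹ʳ a r = begin
    conj a (conj (a ⁻¹) r)  ≡⟨ conj-· a (a ⁻¹) r ⟨
    conj (a · (a ⁻¹)) r     ≡⟨ cong (λ b → conj b r) (inverseʳ a) ⟩
    conj e r                ≡⟨ conj-e r ⟩
    r                       ∎

  conj-injective : ∀ a {r s} → conj a r ≡ conj a s → r ≡ s
  conj-injective a {r} {s} eq = trans (sym (conj-⁻¹ˡ a r)) (trans (cong (conj (a ⁻¹)) eq) (conj-⁻¹ˡ a s))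

  conj-self : ∀ r → conj r r ≡ r
  conj-self r = //-rightDividesʳ r r

  pow-+ : ∀ a i j → pow _·_ e a (i + j) ≡ pow _·_ e a i · pow _·_ e a j
  pow-+ a zero    j = sym (identityˡ _)
  pow-+ a (suc i) j = trans (cong (a ·_) (pow-+ a i j)) (sym (assoc _ _ _))

  pow-suc : ∀ a i → pow _·_ e a i · a ≡ a · pow _·_ e a i
  pow-suc a zero    = trans (identityˡ a) (sym (identityʳ a))
  pow-suc a (suc i) = trans (assoc _ _ _) (cong (a ·_) (pow-suc a i))

  conj-pow : ∀ a b k → conj a (pow _·_ e b k) ≡ pow _·_ e (conj a b) k
  conj-pow a b zero    = conj-fixes-e a
  conj-pow a b (suc k) = trans (conj-homo a b _) (cong (conj a b ·_) (conj-pow a b k))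

  S-involutive : ∀ {s} → s ∈ S → s · s ≡ e
  S-involutive s∈S = proj₂ (S-order2 s∈S)

  S-⁻¹ : ∀ {s} → s ∈ S → s ⁻¹ ≡ s
  S-⁻¹ {s} s∈S = sym (inverseˡ-unique s s (S-involutive s∈S))

  S-cancelˡ : ∀ {s} → s ∈ S → ∀ a → s · (s · a) ≡ a
  S-cancelˡ {s} s∈S a = trans (sym (assoc s s a)) (trans (cong (_· a) (S-involutive s∈S)) (identityˡ a))

  -- The signed action on reflections.

  δ : W → W → Bool
  δ r s = ⌊ r ≟ s ⌋

  δ-cong : ∀ {r s r′ s′} → (r ≡ s → r′ ≡ s′) → (r′ ≡ s′ → r ≡ s) → δ r s ≡ δ r′ s′
  δ-cong {r} {s} {r′} {s′} f g = begin
    δ r s    ≡⟨ isYes≗does (r ≟ s) ⟩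
    _        ≡⟨ does-⇔ (mk⇔ f g) (r ≟ s) (r′ ≟ s′) ⟩
    _        ≡⟨ isYes≗does (r′ ≟ s′) ⟨
    δ r′ s′  ∎

  δ-≡ : ∀ {r s} → r ≡ s → δ r s ≡ true
  δ-≡ {r} {s} eq = Equivalence.to T-≡ (fromWitness {a? = r ≟ s} eq)

  -- The semidirect product of Bool^W (under xor) and W. The homomorphism from W
  -- sending s to (δ_s , s) is Bourbaki's signed action on reflections: its first
  -- component counts, mod 2, how often r occurs among the inversions of a word.
  signedGroup : Group 0ℓ 0ℓ
  signedGroup = record
    { Carrier = (W → Bool) × W
    ; _≈_ = λ x y → (∀ r → proj₁ x r ≡ proj₁ y r) × proj₂ x ≡ proj₂ y
    ; _∙_ = λ x y → (λ r → proj₁ x (conj (proj₂ y) r) xor proj₁ y r) , proj₂ x · proj₂ y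
    ; ε = (λ _ → false) , e
    ; _⁻¹ = λ x → (λ r → proj₁ x (conj (proj₂ x ⁻¹) r)) , proj₂ x ⁻¹
    ; isGroup = record
      { isMonoid = record
        { isSemigroup = record
          { isMagma = record
            { isEquivalence = record
              { refl  = (λ _ → refl) , refl
              ; sym   = λ (p , q) → (λ r → sym (p r)) , sym q
              ; trans = λ (p , q) (p′ , q′) → (λ r → trans (p r) (p′ r)) , trans q q′
              }
            ; ∙-cong = λ { {f , a} {f′ , a′} {g , b} {g′ , b′} (p , q) (p′ , q′) →
                (λ r → cong₂ _xor_ (trans (p _) (cong (λ c → f′ (conj c r)) q′)) (p′ r))
              , cong₂ _·_ q q′ }
            }
          ; assoc = λ (f , a) (g , b) (h , c) →
              (λ r → trans (xor-assoc (f (conj b (conj c r))) (g (conj c r)) (h r))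
                       (cong (λ z → f z xor (g (conj c r) xor h r)) (sym (conj-· b c r))))
            , assoc a b c
          }
        ; identity = (λ (f , a) → (λ r → refl) , identityˡ a)
                   , (λ (f , a) → (λ r → trans (xor-identityʳ _) (cong f (conj-e r))) , identityʳ a)
        }
      ; inverse = (λ (f , a) → (λ r → trans (cong (λ z → f z xor f r) (conj-⁻¹ˡ a r)) (xor-same (f r))) , inverseˡ a)
                , (λ (f , a) → (λ r → xor-same (f (conj (a ⁻¹) r))) , inverseʳ a)
      ; ⁻¹-cong = λ { {f , a} {f′ , a′} (p , q) →
          (λ r → trans (p _) (cong (λ c → f′ (conj (c ⁻¹) r)) q)) , cong _⁻¹ q }
      }
    }

  module Signed = Group signedGroup

  generator : W → Signed.Carrier
  generator s = (λ r → δ r s) , s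

  -- Coxeter relations in the signed group.

  module BraidRelation {s t : W} (s∈S : s ∈ S) (t∈S : t ∈ S) where
    p q : W
    p = s · t
    q = t · s

    -- The palindrome t s t ... t with 2j + 1 letters. Read from the right end, the inversions of
    -- the word (s t)ᵏ are `u 0`, ..., `u (2k − 1)`.
    u : ℕ → W
    u j = pow _·_ e q j · t

    p·q≡e : p · q ≡ e
    p·q≡e = trans (assoc s t (t · s)) (trans (cong (s ·_) (S-cancelˡ t∈S s)) (S-involutive s∈S))

    -- Since `q ⁻¹` is `p` and `t · p` equals `q · t`, conjugation puts one more factor `q` on each
    -- side of the power.
    conj-q-u : ∀ j → conj q (u j) ≡ u (2 + j)
    conj-q-u j = begin
      (q · (x · t)) · (q ⁻¹)  ≡⟨ cong ((q · (x · t)) ·_) (inverseˡ-unique p q p·q≡e) ⟨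
      (q · (x · t)) · p       ≡⟨ assoc _ _ _ ⟩
      q · ((x · t) · p)       ≡⟨ cong (q ·_) (assoc _ _ _) ⟩
      q · (x · (t · p))       ≡⟨ cong (λ z → q · (x · z)) (assoc t s t) ⟨
      q · (x · (q · t))       ≡⟨ cong (q ·_) (assoc _ _ _) ⟨
      q · ((x · q) · t)       ≡⟨ cong (λ z → q · (z · t)) (pow-suc q j) ⟩
      q · ((q · x) · t)       ≡⟨ assoc _ _ _ ⟨
      u (2 + j)               ∎
      where
        x : W
        x = pow _·_ e q j

    conj-p-u : ∀ j → conj p (u (2 + j)) ≡ u j
    conj-p-u j = begin
      conj p (u (2 + j))      ≡⟨ cong (conj p) (conj-q-u j) ⟨
      conj p (conj q (u j))   ≡⟨ conj-· p q (u j) ⟨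
      conj (p · q) (u j)      ≡⟨ cong (λ z → conj z (u j)) p·q≡e ⟩
      conj e (u j)            ≡⟨ conj-e (u j) ⟩
      u j                     ∎

    conj-pow-u : ∀ k j → conj (pow _·_ e p k) (u (k + k + j)) ≡ u j
    conj-pow-u zero    j = conj-e (u j)
    conj-pow-u (suc k) j = begin
      conj (p · x) (u (suc k + suc k + j))      ≡⟨ cong (λ i → conj (p · x) (u i)) shift ⟩
      conj (p · x) (u (k + k + (2 + j)))        ≡⟨ conj-· p x _ ⟩
      conj p (conj x (u (k + k + (2 + j))))     ≡⟨ cong (conj p) (conj-pow-u k (2 + j)) ⟩
      conj p (u (2 + j))                        ≡⟨ conj-p-u j ⟩
      u j                                       ∎
      where
        x : W
        x = pow _·_ e p k
        shift : suc k + suc k + j ≡ k + k + (2 + j)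
        shift = trans (cong (λ z → suc (z + j)) (+-suc k k))
                  (sym (trans (+-suc (k + k) (suc j)) (cong suc (+-suc (k + k) j))))

    δ-conj-pow : ∀ k j r → δ (conj (pow _·_ e p k) r) (u j) ≡ δ r (u (k + k + j))
    δ-conj-pow k j r = δ-cong
      (λ eq → conj-injective (pow _·_ e p k) (trans eq (sym (conj-pow-u k j))))
      (λ eq → trans (cong (conj (pow _·_ e p k)) eq) (conj-pow-u k j))

    u₁≡conj : u 1 ≡ conj t s
    u₁≡conj = cong₂ _·_ (identityʳ q) (sym (S-⁻¹ t∈S))

    δ-u₁ : ∀ r → δ (conj t r) s ≡ δ r (u 1)
    δ-u₁ r = δ-cong
      (λ eq → sym (trans u₁≡conj (trans (cong (conj t) (sym eq)) (conj-t² r))))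
      (λ eq → trans (cong (conj t) (trans eq u₁≡conj)) (conj-t² s))
      where
        conj-t² : ∀ r → conj t (conj t r) ≡ r
        conj-t² r = trans (sym (conj-· t t r)) (trans (cong (λ z → conj z r) (S-involutive t∈S)) (conj-e r))

    -- As qᵐ = e the sequence u has period m, so each r occurs an even number of
    -- times among the 2m terms u 0 , … , u (2m − 1) that make up (s t)ᵐ.
    parity : ℕ → W → Bool
    parity zero    r = false
    parity (suc j) r = δ r (u j) xor parity j r

    -- Each further factor s t on the left contributes the next two terms of `u`, hence the index
    -- `k + k`.
    generator-pow : ∀ k → pow Signed._∙_ Signed.ε (generator s Signed.∙ generator t) k
                          Signed.≈ ((λ r → parity (k + k) r) , pow _·_ e p k)
    generator-pow zero    = (λ _ → refl) , refl
    generator-pow (suc k) with eq₁ , eq₂ ← generator-pow k = parities , cong (p ·_) eq₂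
      where
        x : W
        x = pow _·_ e p k
        parities : ∀ r → _
        parities r = begin
          _ ≡⟨ cong₂ (λ z b → (δ (conj t (conj z r)) s xor δ (conj z r) t) xor b) eq₂ (eq₁ r) ⟩
          -- The letters `s` and `t` of the new factor test for `u 1` and `u 0`; pulling back along
          -- `conj x` raises both indices by `k + k`.
          (δ (conj t (conj x r)) s xor δ (conj x r) t) xor parity (k + k) r
            ≡⟨ cong (_xor parity (k + k) r) (cong₂ _xor_
                 (trans (δ-u₁ (conj x r)) (trans (δ-conj-pow k 1 r)
                   (cong (λ i → δ r (u i)) (trans (+-suc (k + k) 0) (cong suc (+-identityʳ (k + k)))))))
                 (trans (cong (δ (conj x r)) (sym (identityˡ t))) (trans (δ-conj-pow k 0 r)
                   (cong (λ i → δ r (u i)) (+-identityʳ (k + k)))))) ⟩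
          (δ r (u (suc (k + k))) xor δ r (u (k + k))) xor parity (k + k) r
            ≡⟨ xor-assoc (δ r (u (suc (k + k)))) _ _ ⟩
          parity (suc (suc (k + k))) r
            ≡⟨ cong (λ i → parity (suc i) r) (+-suc k k) ⟨
          parity (suc k + suc k) r ∎

    module _ {m : ℕ} (pᵐ≡e : pow _·_ e p m ≡ e) where
      -- `q` is the conjugate of `p` by `t`, so its `m`-th power is a conjugate of `e`.
      qᵐ≡e : pow _·_ e q m ≡ e
      qᵐ≡e = begin
        pow _·_ e q m            ≡⟨ cong (λ z → pow _·_ e z m) conj-t-p ⟨
        pow _·_ e (conj t p) m   ≡⟨ conj-pow t p m ⟨
        conj t (pow _·_ e p m)   ≡⟨ cong (conj t) pᵐ≡e ⟩
        conj t e                 ≡⟨ conj-fixes-e t ⟩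
        e                        ∎
        where
          conj-t-p : conj t p ≡ q
          conj-t-p = trans (cong (_· (t ⁻¹)) (sym (assoc t s t))) (//-rightDividesʳ t q)

      u-periodic : ∀ j → u (j + m) ≡ u j
      u-periodic j = cong (_· t) (trans (pow-+ q j m) (trans (cong (pow _·_ e q j ·_) qᵐ≡e) (identityʳ _)))

      parity-+ : ∀ j r → parity (j + m) r ≡ parity j r xor parity m r
      parity-+ zero    r = refl
      parity-+ (suc j) r = trans (cong₂ (λ z b → δ r z xor b) (u-periodic j) (parity-+ j r))
                                 (sym (xor-assoc (δ r (u j)) _ _))

      generator-relation : pow Signed._∙_ Signed.ε (generator s Signed.∙ generator t) m Signed.≈ Signed.ε
      generator-relation with eq₁ , eq₂ ← generator-pow m =
        (λ r → trans (eq₁ r) (trans (parity-+ m r) (xor-same (parity m r)))) , trans eq₂ pᵐ≡e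

  -- The inversion cocycle.

  private
    signedHomomorphism : ∃[ φ ] (GroupMorphisms.IsGroupHomomorphism (Group.rawGroup group) Signed.rawGroup φ
                                 × (∀ {s} → s ∈ S → φ s Signed.≈ generator s))
    signedHomomorphism = presentation signedGroup generator
      (λ s∈S t∈S m (_ , pᵐ≡e , _) → BraidRelation.generator-relation s∈S t∈S {m} pᵐ≡e)

    φ : W → Signed.Carrier
    φ = proj₁ signedHomomorphism

    open GroupMorphisms.IsGroupHomomorphism (proj₁ (proj₂ signedHomomorphism)) using (homo; ε-homo)

    φ-S : ∀ {s} → s ∈ S → φ s Signed.≈ generator s
    φ-S = proj₂ (proj₂ signedHomomorphism)

    proj₂-φ-prod : ∀ {ws} → All (_∈ S) ws → proj₂ (φ (prod ws)) ≡ prod ws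
    proj₂-φ-prod []           = proj₂ ε-homo
    proj₂-φ-prod (s∈S ∷ ws∈S) = trans (proj₂ (homo _ _)) (cong₂ _·_ (proj₂ (φ-S s∈S)) (proj₂-φ-prod ws∈S))

    -- The second component of `φ` is multiplicative and fixes `S`, so it is the identity on
    -- products of generators.
    proj₂-φ : ∀ w → proj₂ (φ w) ≡ w
    proj₂-φ w with ws , ws∈S , refl ← S-generates w = proj₂-φ-prod ws∈S

  η : W → W → Bool
  η w = proj₁ (φ w)

  -- First component of the semidirect multiplication; `proj₂-φ` identifies the conjugating element
  -- as `b`.
  η-· : ∀ a b r → η (a · b) r ≡ η a (conj b r) xor η b r
  η-· a b r = trans (proj₁ (homo a b) r) (cong (λ c → η a (conj c r) xor η b r) (proj₂-φ b))

  η-e : ∀ r → η e r ≡ false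
  η-e = proj₁ ε-homo

  η-S : ∀ {s} → s ∈ S → ∀ r → η s r ≡ δ r s
  η-S s∈S = proj₁ (φ-S s∈S)

  η-S· : ∀ {s} → s ∈ S → ∀ w r → η (s · w) r ≡ δ (conj w r) s xor η w r
  η-S· {s} s∈S w r = trans (η-· s w r) (cong (_xor η w r) (η-S s∈S (conj w r)))

  -- In w s w⁻¹ the contributions of w and w⁻¹ cancel mod 2, and the middle letter s contributes one
  -- occurrence.
  η-reflection : ∀ {r} → IsReflection r → η r r ≡ true
  η-reflection (w , s , s∈S , refl) = begin
    η (conj w s) (conj w s)
      ≡⟨ η-· (w · s) (w ⁻¹) (conj w s) ⟩
    η (w · s) (conj (w ⁻¹) (conj w s)) xor η (w ⁻¹) (conj w s)
      ≡⟨ cong (λ z → η (w · s) z xor η (w ⁻¹) (conj w s)) (conj-⁻¹ˡ w s) ⟩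
    η (w · s) s xor η (w ⁻¹) (conj w s)
      ≡⟨ cong (_xor η (w ⁻¹) (conj w s)) η-ws ⟩
    (η w s xor true) xor η (w ⁻¹) (conj w s)
      ≡⟨ flip-xor (η w s) _ (trans (sym (η-· (w ⁻¹) w s)) (trans (cong (λ z → η z s) (inverseˡ w)) (η-e s))) ⟩
    true ∎
    where
      η-ws : η (w · s) s ≡ η w s xor true
      η-ws = trans (η-· w s s) (cong₂ _xor_ (cong (η w) (conj-self s)) (trans (η-S s∈S s) (δ-≡ refl)))
      flip-xor : ∀ x y → y xor x ≡ false → (x xor true) xor y ≡ true
      flip-xor true  true  _ = refl
      flip-xor false false _ = refl

  -- Words, length and the exchange property.

  IsWord : W → List W → Set
  IsWord w ws = All (_∈ S) ws × prod ws ≡ w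

  ∈-words⁺ : ∀ {ws} → All (_∈ S) ws → ws ∈ words (length ws)
  ∈-words⁺ []           = here refl
  ∈-words⁺ (s∈S ∷ ws∈S) = ∈-concatMap⁺ _ (lose s∈S (∈-map⁺ _ (∈-words⁺ ws∈S)))

  ∈-words⁻ : ∀ n {ws} → ws ∈ words n → All (_∈ S) ws × length ws ≡ n
  ∈-words⁻ zero    (here refl) = [] , refl
  ∈-words⁻ (suc n) ws∈ with s , s∈S , ws∈map ← find (∈-concatMap⁻ _ {xs = S} ws∈)
                       with _ , vs∈ , refl ← ∈-map⁻ _ ws∈map
                       with vs∈S , len ← ∈-words⁻ n vs∈ = s∈S ∷ vs∈S , cong suc len

  hasWordOfLength⁺ : ∀ {w ws} → IsWord w ws → hasWordOfLength w (length ws) ≡ true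
  hasWordOfLength⁺ {w} {ws} (ws∈S , eq) = Equivalence.to T-≡
    (Any.any⁺ _ (lose (∈-words⁺ ws∈S) (fromWitness {a? = prod ws ≟ w} eq)))

  hasWordOfLength⁻ : ∀ w n → hasWordOfLength w n ≡ true → ∃[ ws ] (IsWord w ws × length ws ≡ n)
  hasWordOfLength⁻ w n eq
    with ws , ws∈ , t ← find (Any.any⁻ _ (words n) (Equivalence.from T-≡ eq))
    with ws∈S , len ← ∈-words⁻ n ws∈ = ws , (ws∈S , toWitness {a? = prod ws ≟ w} t) , len

  private
    k<n : ∀ {w k n} → hasWordOfLength w k ≡ false → hasWordOfLength w n ≡ true → k ≤ n → k < n
    k<n no-k has-n k≤n = ≤∧≢⇒< k≤n λ { refl → contradiction (trans (sym no-k) has-n) λ () }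

  search-≤ : ∀ w k f {n} → hasWordOfLength w n ≡ true → k ≤ n → search w k f ≤ n
  search-≤ w k zero    has-n k≤n = k≤n
  search-≤ w k (suc f) has-n k≤n with hasWordOfLength w k in eq
  ... | true  = k≤n
  ... | false = search-≤ w (suc k) f has-n (k<n {w} eq has-n k≤n)

  -- With no fuel left `search` returns `k` unchecked; there the two bounds on `n` force `k` to
  -- equal the known length `n`.
  search-sound : ∀ w k f {n} → hasWordOfLength w n ≡ true → k ≤ n → n ≤ k + f →
                 hasWordOfLength w (search w k f) ≡ true
  search-sound w k zero {n} has-n k≤n n≤k =
    subst (λ i → hasWordOfLength w i ≡ true) (≤-antisym (≤-trans n≤k (≤-reflexive (+-identityʳ k))) k≤n) has-n
  search-sound w k (suc f) has-n k≤n n≤k+f with hasWordOfLength w k in eq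
  ... | true  = eq
  ... | false = search-sound w (suc k) f has-n (k<n {w} eq has-n k≤n) (≤-trans n≤k+f (≤-reflexive (+-suc k f)))

  prod-++ : ∀ us vs → prod (us ++ vs) ≡ prod us · prod vs
  prod-++ []       vs = sym (identityˡ _)
  prod-++ (u ∷ us) vs = trans (cong (u ·_) (prod-++ us vs)) (sym (assoc _ _ _))

  index-injective : ∀ {v w} → Any.index (elems-complete v) ≡ Any.index (elems-complete w) → v ≡ w
  index-injective {v} {w} eq =
    trans (Any.lookup-index (elems-complete v))
      (trans (cong (lookup elems) eq) (sym (Any.lookup-index (elems-complete w))))

  -- Two suffixes of a word with more than |W| letters have the same product,
  -- so the segment between them can be cut out.
  cut-long-word : ∀ {w ws} → IsWord w ws → length elems < length ws →
                  ∃[ vs ] (IsWord w vs × length vs < length ws)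
  cut-long-word {w} {ws} (ws∈S , eq) long
    with i , j , i<j , same ← pigeonhole long
           (λ (k : Fin (length ws)) → Any.index (elems-complete (prod (drop (toℕ k) ws))))
    = take m ws ++ drop n ws
    , (All.++⁺ (All.take⁺ m ws∈S) (All.drop⁺ n ws∈S) , prod-cut)
    , length-cut
    where
      m n : ℕ
      m = toℕ i
      n = toℕ j
      prod-cut : prod (take m ws ++ drop n ws) ≡ w
      prod-cut = begin
        prod (take m ws ++ drop n ws)         ≡⟨ prod-++ (take m ws) _ ⟩
        prod (take m ws) · prod (drop n ws)   ≡⟨ cong (prod (take m ws) ·_) (index-injective same) ⟨
        prod (take m ws) · prod (drop m ws)   ≡⟨ prod-++ (take m ws) _ ⟨
        prod (take m ws ++ drop m ws)         ≡⟨ cong prod (take++drop≡id m ws) ⟩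
        prod ws                               ≡⟨ eq ⟩
        w                                     ∎
      drop-< : length (drop n ws) < length (drop m ws)
      drop-< = subst₂ _<_ (sym (length-drop n ws)) (sym (length-drop m ws)) (∸-monoʳ-< i<j (<⇒≤ (toℕ<n j)))
      length-cut : length (take m ws ++ drop n ws) < length ws
      length-cut = subst₂ _<_ (sym (length-++ (take m ws)))
        (trans (sym (length-++ (take m ws))) (cong length (take++drop≡id m ws)))
        (+-monoʳ-< (length (take m ws)) drop-<)

  -- Cuts are repeated until the word is short; the length bound `b` serves as the recursion
  -- measure.
  short-word : ∀ {w} b {ws} → IsWord w ws → length ws ≤ b → ∃[ vs ] (IsWord w vs × length vs ≤ length elems)
  short-word b {ws} word ≤b with length ws ≤? length elems
  ... | yes short = ws , word , short
  short-word zero    {ws} word ≤b | no ¬short = contradiction (≤-trans ≤b z≤n) ¬short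
  short-word (suc b) {ws} word ≤b | no ¬short with vs , word′ , vs<ws ← cut-long-word word (≰⇒> ¬short) =
    short-word b word′ (s≤s⁻¹ (≤-trans vs<ws ≤b))

  ℓ-≤ : ∀ {w ws} → IsWord w ws → ℓ w ≤ length ws
  ℓ-≤ {w} word = search-≤ w 0 (length elems) (hasWordOfLength⁺ word) z≤n

  -- Some word for `w` has at most |W| letters, so the fuel in `ℓ` suffices and the search ends at a
  -- length that is attained.
  reduced-word : ∀ w → ∃[ ws ] (IsWord w ws × length ws ≡ ℓ w)
  reduced-word w
    with ws , ws∈S , eq ← S-generates w
    with vs , word , short ← short-word (length ws) (ws∈S , eq) ≤-refl =
    hasWordOfLength⁻ w (ℓ w) (search-sound w 0 (length elems) (hasWordOfLength⁺ word) z≤n short)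

  -- Strong exchange. By the cocycle identity, either the leading letter `s` is the one that
  -- multiplication by `t` deletes, or the odd parity passes to the tail, where the recursion
  -- deletes a letter.
  exchange : ∀ {w ws t} → IsWord w ws → η w t ≡ true → ∃[ vs ] (IsWord (w · t) vs × length vs < length ws)
  exchange {t = t} ([] , refl) ηt = contradiction (trans (sym (η-e t)) ηt) λ ()
  exchange {ws = s ∷ ws} {t} (s∈S ∷ ws∈S , refl) ηt with conj (prod ws) t ≟ s | trans (sym (η-S· s∈S (prod ws) t)) ηt
  ... | yes eq | _ = ws , (ws∈S , (begin
    prod ws                             ≡⟨ S-cancelˡ s∈S (prod ws) ⟨
    s · (s · prod ws)                   ≡⟨ cong (λ z → s · (z · prod ws)) eq ⟨
    s · (conj (prod ws) t · prod ws)    ≡⟨ cong (s ·_) (conj-swap (prod ws) t) ⟩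
    s · (prod ws · t)                   ≡⟨ assoc s (prod ws) t ⟨
    (s · prod ws) · t                   ∎)) , ≤-refl
  ... | no _ | η-tail with vs , (vs∈S , vs-eq) , vs<ws ← exchange {ws = ws} {t} (ws∈S , refl) η-tail =
    s ∷ vs , (s∈S ∷ vs∈S , trans (cong (s ·_) vs-eq) (sym (assoc s (prod ws) t))) , s≤s vs<ws

  η⇒ℓ-< : ∀ {w t} → η w t ≡ true → ℓ (w · t) < ℓ w
  η⇒ℓ-< {w} ηt with ws , word , len ← reduced-word w
               with vs , word′ , vs<ws ← exchange word ηt =
    ≤-trans (s≤s (ℓ-≤ word′)) (≤-trans vs<ws (≤-reflexive len))

  reflection-involutive : ∀ {r} → IsReflection r → r · r ≡ e
  reflection-involutive (w , s , s∈S , refl) =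
    trans (sym (conj-homo w s s)) (trans (cong (conj w) (S-involutive s∈S)) (conj-fixes-e w))

  -- Odd parity lowers the length by exchange. If the parity is even at `w`, it is odd at `w · r`,
  -- and exchange applied there shows that the length rises from `w` to `w · r`.
  ℓ-descent : ∀ {r} → IsReflection r → ∀ w → (ℓ (w · r) <ᵇ ℓ w) ≡ η w r
  ℓ-descent {r} refl-r w with η w r in ηr
  ... | true  = Equivalence.to T-≡ (<⇒<ᵇ (η⇒ℓ-< ηr))
  ... | false with ℓ (w · r) <ᵇ ℓ w in eq
  ...   | false = refl
  ...   | true  = contradiction (<ᵇ⇒< _ _ (Equivalence.from T-≡ eq)) (<-asym ℓ-up)
    where
      η-wr : η (w · r) r ≡ true
      η-wr = trans (η-· w r r) (cong₂ _xor_ (trans (cong (η w) (conj-self r)) ηr) (η-reflection refl-r))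
      ℓ-up : ℓ w < ℓ (w · r)
      ℓ-up = subst (λ v → ℓ v < ℓ (w · r))
        (trans (assoc w r r) (trans (cong (w ·_) (reflection-involutive refl-r)) (identityʳ w))) (η⇒ℓ-< η-wr)

  -- An involution is injective and hits everything, so it permutes the duplicate-free list of all
  -- elements.
  sum-involution : ∀ (f : W → ℤ) {σ} → (∀ a → σ (σ a) ≡ a) → Σ[w∈W] (λ a → f (σ a)) ≡ Σ[w∈W] f
  sum-involution f {σ} σσ = trans (sym (foldr-map (λ a acc → f a +ℤ acc) σ 0ℤ elems)) (sum-↭ f permutation)
    where
      permutation : map σ elems ↭ elems
      permutation = ∼bag⇒↭ (unique∧set⇒bag
        (Unique.map⁺ (λ {a} {b} eq → trans (sym (σσ a)) (trans (cong σ eq) (σσ b))) elems-unique)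
        elems-unique
        (λ {a} → mk⇔ (λ _ → elems-complete a) (λ _ → subst (_∈ map σ elems) (σσ a) (∈-map⁺ σ (elems-complete (σ a))))))

  -- Descent classes and their connectedness.

  module _ (A : W → Bool) (A-reflections : ∀ r → T (A r) → IsReflection r) where

    infix 4 _≈_
    -- Equality of A-descent sets, stated through `η` so that the cocycle identity applies directly.
    _≈_ : W → W → Set
    v ≈ w = ∀ r → T (A r) → η v r ≡ η w r

    descent-η : ∀ w r → descent A w r ≡ A r ∧ η w r
    descent-η w r with A r in eq
    ... | false = refl
    ... | true  = ℓ-descent (A-reflections r (Equivalence.from T-≡ eq)) w

    ≈⇒sameDescent : ∀ {v w} → v ≈ w → sameDescent A v w ≡ true
    ≈⇒sameDescent {v} {w} v≈w = Equivalence.to T-≡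
      (All.all⁻ (λ r → ⌊ descent A v r ≟ᵇ descent A w r ⌋)
        (All.tabulate {xs = elems} λ {r} _ → fromWitness (same r)))
      where
        same : ∀ r → descent A v r ≡ descent A w r
        same r = trans (descent-η v r) (trans (lemma r) (sym (descent-η w r)))
          where
            lemma : ∀ r → A r ∧ η v r ≡ A r ∧ η w r
            lemma r with A r in eq
            ... | false = refl
            ... | true  = v≈w r (Equivalence.from T-≡ eq)

    sameDescent⇒≈ : ∀ {v w} → sameDescent A v w ≡ true → v ≈ w
    sameDescent⇒≈ {v} {w} eq r Ar = subst (λ b → b ∧ η v r ≡ b ∧ η w r) (Equivalence.to T-≡ Ar)
      (trans (sym (descent-η v r)) (trans same (descent-η w r)))
      where
        same : descent A v r ≡ descent A w r
        same = toWitness (All.lookup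
          (All.all⁺ (λ r → ⌊ descent A v r ≟ᵇ descent A w r ⌋) elems (Equivalence.from T-≡ eq))
          (elems-complete r))

    -- Descent classes are connected under v ↦ s · v: along a reduced word of
    -- v′ v⁻¹ each inversion is crossed exactly once, hence lies outside A.
    constant-on-classes : ∀ {X : Set} (x : W → X) →
      (∀ {s} v → s ∈ S → ¬ T (A (conj (v ⁻¹) s)) → x (s · v) ≡ x v) →
      ∀ {v v′} → v ≈ v′ → x v′ ≡ x v
    constant-on-classes x step {v} {v′} v≈v′
      with ws , (ws∈S , ws-eq) , len ← reduced-word (v′ · (v ⁻¹)) =
      trans (cong x (sym ws·v)) (along ws∈S reduced fixed)
      where
        Reduced : List W → Set
        Reduced us = ∀ {vs} → IsWord (prod us) vs → length us ≤ length vs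
        reduced : Reduced ws
        reduced word = ≤-trans (≤-reflexive (trans len (cong ℓ (sym ws-eq)))) (ℓ-≤ word)
        ws·v : prod ws · v ≡ v′
        ws·v = trans (cong (_· v) ws-eq) (//-rightDividesˡ v v′)
        -- Equal parities of `v` and `v′` on A mean, by the cocycle identity, that the connecting
        -- element has even parity at every `conj v r`.
        fixed : ∀ r → T (A r) → η (prod ws) (conj v r) ≡ false
        fixed r Ar = xor-cancel _ _ (begin
          η (prod ws) (conj v r) xor η v r  ≡⟨ η-· (prod ws) v r ⟨
          η (prod ws · v) r                 ≡⟨ cong (λ z → η z r) ws·v ⟩
          η v′ r                            ≡⟨ v≈v′ r Ar ⟨
          η v r                             ∎)
          where
            xor-cancel : ∀ a b → a xor b ≡ b → a ≡ false
            xor-cancel false b     _ = refl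
            xor-cancel true  true  ()
            xor-cancel true  false ()
        along : ∀ {us} → All (_∈ S) us → Reduced us →
                (∀ r → T (A r) → η (prod us) (conj v r) ≡ false) → x (prod us · v) ≡ x v
        along [] _ _ = cong x (identityˡ v)
        along {s ∷ us} (s∈S ∷ us∈S) red η-false =
          trans (cong x (assoc s (prod us) v))
            (trans (step (prod us · v) s∈S not-in-A) (along us∈S red-tail (λ r Ar → proj₂ (both r Ar))))
          where
            red-tail : Reduced us
            red-tail {vs} (vs∈S , eq) = s≤s⁻¹ (red {s ∷ vs} (s∈S ∷ vs∈S , cong (s ·_) eq))
            crossing : ∀ t → conj (prod us) t ≡ s → prod us · t ≡ s · prod us
            crossing t eq = trans (sym (conj-swap (prod us) t)) (cong (_· prod us) eq)
            -- Otherwise exchange would give `s · prod us` a word shorter than `us`, although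
            -- `s ∷ us` is reduced.
            not-shorter : ∀ t → conj (prod us) t ≡ s → ¬ (η (prod us) t ≡ true)
            not-shorter t eq ηt with vs , (vs∈S , vs-eq) , vs<us ← exchange (us∈S , refl) ηt =
              <⇒≱ vs<us (≤-trans (n≤1+n _) (red (vs∈S , trans vs-eq (crossing t eq))))
            -- The two values have xor `false`, and they cannot both be `true` by `not-shorter`.
            both : ∀ r → T (A r) → δ (conj (prod us) (conj v r)) s ≡ false × η (prod us) (conj v r) ≡ false
            both r Ar with conj (prod us) (conj v r) ≟ s | trans (sym (η-S· s∈S (prod us) (conj v r))) (η-false r Ar)
            ... | no  _ | eq = refl , eq
            ... | yes p | eq = contradiction (not-false eq) (not-shorter (conj v r) p)
              where
                not-false : ∀ {b} → true xor b ≡ false → b ≡ true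
                not-false {true} _ = refl
            not-in-A : ¬ T (A (conj ((prod us · v) ⁻¹) s))
            not-in-A Ar = contradiction (trans (sym (proj₁ (both _ Ar))) (δ-≡ (begin
              conj (prod us) (conj v t)   ≡⟨ conj-· (prod us) v t ⟨
              conj (prod us · v) t        ≡⟨ conj-⁻¹ʳ (prod us · v) s ⟩
              s                           ∎))) λ ()
              where
                t : W
                t = conj ((prod us · v) ⁻¹) s

    -- Left multiplication by `s` alters `η v` only at v⁻¹ s v, which lies outside A.
    step-≈ : ∀ {s} v → s ∈ S → ¬ T (A (conj (v ⁻¹) s)) → s · v ≈ v
    step-≈ {s} v s∈S ∉A r Ar = trans (η-S· s∈S v r) (cong (_xor η v r) ≢s)
      where
        ≢s : δ (conj v r) s ≡ false
        ≢s with conj v r ≟ s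
        ... | no  _ = refl
        ... | yes p = contradiction (subst (λ z → T (A z)) (trans (sym (conj-⁻¹ˡ v r)) (cong (conj (v ⁻¹)) p)) Ar) ∉A

    -- The span of the class sums as functions constant on classes.

    sameDescent-congˡ : ∀ {v v′} → v ≈ v′ → ∀ w → sameDescent A v w ≡ sameDescent A v′ w
    sameDescent-congˡ {v} {v′} v≈v′ w = ⇔→≡ {z = true} (mk⇔
      (λ eq → ≈⇒sameDescent λ r Ar → trans (sym (v≈v′ r Ar)) (sameDescent⇒≈ {v} {w} eq r Ar))
      (λ eq → ≈⇒sameDescent λ r Ar → trans (v≈v′ r Ar) (sameDescent⇒≈ {v′} {w} eq r Ar)))

    d-cong : ∀ {v v′} → v ≈ v′ → ∀ w → d A w v ≡ d A w v′
    d-cong v≈v′ w = cong (λ b → if b then 1ℤ else 0ℤ) (sameDescent-congˡ v≈v′ w)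

    In𝒟⇒constant : ∀ {x} → In𝒟 A x → ∀ {v v′} → v ≈ v′ → x v ≡ x v′
    In𝒟⇒constant {x} (c , eq) {v} {v′} v≈v′ = begin
      x v                                    ≡⟨ eq v ⟩
      Σ[w∈W] (λ w → c w *ℤ d A w v)          ≡⟨ sum-cong elems (λ w → cong (c w *ℤ_) (d-cong v≈v′ w)) ⟩
      Σ[w∈W] (λ w → c w *ℤ d A w v′)         ≡⟨ eq v′ ⟨
      x v′                                   ∎

    -- `v` lies in `elems` and passes its own test, so the search succeeds and `e` is only a
    -- placeholder.
    representative : W → W
    representative v = first (sameDescent A v) e elems

    representative-≈ : ∀ v → v ≈ representative v
    representative-≈ v = sameDescent⇒≈
      (first-satisfies (sameDescent A v) (elems-complete v) (≈⇒sameDescent λ _ _ → refl))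

    representative-cong : ∀ {v v′} → v ≈ v′ → representative v ≡ representative v′
    representative-cong v≈v′ = first-cong (sameDescent-congˡ v≈v′) elems

    -- The family `d A w` repeats each class sum once for every member of the class. Coefficients
    -- supported on the representatives count each class once, so a single term survives at `v`.
    constant⇒In𝒟 : ∀ {x} → (∀ {v v′} → v ≈ v′ → x v ≡ x v′) → In𝒟 A x
    constant⇒In𝒟 {x} const = c , λ v → sym (trans
      (sum-single elems-unique (elems-complete (representative v)) (others v)) (at-representative v))
      where
        c : W → ℤ
        c w = if ⌊ w ≟ representative w ⌋ then x w else 0ℤ
        at-representative : ∀ v → c (representative v) *ℤ d A (representative v) v ≡ x v
        -- `representative` is idempotent, so the coefficient at `representative v` is the value of
        -- `x` there.
        at-representative v
          rewrite δ-≡ (representative-cong (representative-≈ v))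
                | ≈⇒sameDescent (representative-≈ v) = trans (ℤₚ.*-identityʳ _) (sym (const (representative-≈ v)))
        others : ∀ v w → w ≢ representative v → c w *ℤ d A w v ≡ 0ℤ
        others v w w≢ with w ≟ representative w | sameDescent A v w in same
        ... | no  _ | _     = refl
        ... | yes _ | false = ℤₚ.*-zeroʳ (x w)
        ... | yes p | true  = contradiction (trans p (sym (representative-cong (sameDescent⇒≈ {v} {w} same)))) w≢

    -- Closure under multiplication.

    module _ (A-closed : ∀ {r} → T (A r) → r ∈ S ⊎ (∀ b → T (A (conj b r)))) where

      -- Lifts the step v ↦ s · v to factorisations v = a · b: either s · a stays in
      -- the class of a, or r = a⁻¹ s a lies in A and r · b stays in the class of b.
      lift : W → W → W
      lift s a = if A (conj (a ⁻¹) s) then a else s · a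

      -- As `s` commutes with itself, `a` and `s · a` pass the same test in `lift`; this makes
      -- `lift s` an involution.
      conj-step : ∀ {s} → s ∈ S → ∀ a → conj ((s · a) ⁻¹) s ≡ conj (a ⁻¹) s
      conj-step {s} s∈S a = begin
        conj ((s · a) ⁻¹) s             ≡⟨ cong (λ z → conj z s) (⁻¹-anti-homo-∙ s a) ⟩
        conj ((a ⁻¹) · (s ⁻¹)) s        ≡⟨ conj-· (a ⁻¹) (s ⁻¹) s ⟩
        conj (a ⁻¹) (conj (s ⁻¹) s)     ≡⟨ cong (λ z → conj (a ⁻¹) (conj z s)) (S-⁻¹ s∈S) ⟩
        conj (a ⁻¹) (conj s s)          ≡⟨ cong (conj (a ⁻¹)) (conj-self s) ⟩
        conj (a ⁻¹) s                   ∎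

      lift-involutive : ∀ {s} → s ∈ S → ∀ a → lift s (lift s a) ≡ a
      lift-involutive {s} s∈S a with A (conj (a ⁻¹) s) in eq
      ... | true  rewrite eq = refl
      ... | false rewrite conj-step s∈S a | eq = S-cancelˡ s∈S a

      -- `lift s` matches the factorisations of `s · v` with those of `v`; corresponding factors
      -- have equal descent sets, so the sums agree term by term.
      *W-step : ∀ {x y} → (∀ {v v′} → v ≈ v′ → x v ≡ x v′) → (∀ {v v′} → v ≈ v′ → y v ≡ y v′) →
                ∀ {s} v → s ∈ S → ¬ T (A (conj (v ⁻¹) s)) → (x *W y) (s · v) ≡ (x *W y) v
      *W-step {x} {y} x-const y-const {s} v s∈S ∉A = begin
        (x *W y) (s · v)                                                  ≡⟨ sum-cong elems term ⟩
        Σ[w∈W] (λ a → x (lift s a) *ℤ y ((lift s a ⁻¹) · v))              ≡⟨ sum-involution (λ a → x a *ℤ y ((a ⁻¹) · v)) (lift-involutive s∈S) ⟩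
        (x *W y) v                                                        ∎
        where
          -- For b = a⁻¹ v and r = a⁻¹ s a this says b⁻¹ r b = v⁻¹ s v, which carries the assumption
          -- on `v` over to b.
          conj-quotient : ∀ a → conj (((a ⁻¹) · v) ⁻¹) (conj (a ⁻¹) s) ≡ conj (v ⁻¹) s
          conj-quotient a = begin
            conj (((a ⁻¹) · v) ⁻¹) (conj (a ⁻¹) s)   ≡⟨ conj-· _ (a ⁻¹) s ⟨
            conj ((((a ⁻¹) · v) ⁻¹) · (a ⁻¹)) s      ≡⟨ cong (λ z → conj z s) (begin
              (((a ⁻¹) · v) ⁻¹) · (a ⁻¹)               ≡⟨ ⁻¹-anti-homo-∙ a ((a ⁻¹) · v) ⟨
              (a · ((a ⁻¹) · v)) ⁻¹                    ≡⟨ cong _⁻¹ (\\-leftDividesˡ a v) ⟩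
              v ⁻¹                                     ∎) ⟩
            conj (v ⁻¹) s                            ∎
          term : ∀ a → x a *ℤ y ((a ⁻¹) · (s · v)) ≡ x (lift s a) *ℤ y ((lift s a ⁻¹) · v)
          term a with A (conj (a ⁻¹) s) in eq
          -- The first factor moves along an edge to `s · a`, while the second factor is unchanged.
          ... | false = cong₂ _*ℤ_
            (sym (x-const (step-≈ a s∈S λ ∈A → subst T eq ∈A)))
            (cong y (sym (begin
              ((s · a) ⁻¹) · v          ≡⟨ cong (_· v) (⁻¹-anti-homo-∙ s a) ⟩
              ((a ⁻¹) · (s ⁻¹)) · v     ≡⟨ assoc _ _ _ ⟩
              (a ⁻¹) · ((s ⁻¹) · v)     ≡⟨ cong (λ z → (a ⁻¹) · (z · v)) (S-⁻¹ s∈S) ⟩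
              (a ⁻¹) · (s · v)          ∎)))
          ... | true with A-closed (Equivalence.from T-≡ eq)
          -- All conjugates of r would lie in A, among them v⁻¹ s v.
          ...   | inj₂ closed = contradiction (subst (λ z → T (A z)) (conj-quotient a) (closed _)) ∉A
          -- Now r is simple, so the second factor moves along an edge from b to r b.
          ...   | inj₁ r∈S = cong (x a *ℤ_) (trans (cong y quotient)
                    (y-const (step-≈ ((a ⁻¹) · v) r∈S λ ∈A → ∉A (subst (λ z → T (A z)) (conj-quotient a) ∈A))))
            where
              quotient : (a ⁻¹) · (s · v) ≡ conj (a ⁻¹) s · ((a ⁻¹) · v)
              quotient = begin
                (a ⁻¹) · (s · v)                   ≡⟨ assoc _ _ _ ⟨
                ((a ⁻¹) · s) · v                   ≡⟨ cong (_· v) (conj-swap (a ⁻¹) s) ⟨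
                (conj (a ⁻¹) s · (a ⁻¹)) · v       ≡⟨ assoc _ _ _ ⟩
                conj (a ⁻¹) s · ((a ⁻¹) · v)       ∎

      In𝒟-*W : ∀ {x y} → In𝒟 A x → In𝒟 A y → In𝒟 A (x *W y)
      In𝒟-*W {x} {y} x∈ y∈ = constant⇒In𝒟 λ v≈v′ →
        sym (constant-on-classes (x *W y) (*W-step (In𝒟⇒constant x∈) (In𝒟⇒constant y∈)) v≈v′)

-- Unions of simple reflections and conjugacy classes.

open FiniteCoxeterSystem using (W; S)
open Coxeter using (IsReflection; InConjClass; ℤW; _*W_; In𝒟)

theoremA : (C : FiniteCoxeterSystem) (A : W C → Bool) →
    (∀ r → T (A r) → IsReflection C r) →
    (∃[ S₁ ] ∃[ S₂ ] (All (_∈ S C) S₁ × All (_∈ S C) S₂ ×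
    (∀ r → T (A r) ⇔ (r ∈ S₁ ⊎ ∃[ s ] (s ∈ S₂ × InConjClass C s r))))) →
    (x y : ℤW C) → In𝒟 C A x → In𝒟 C A y → In𝒟 C A (_*W_ C x y)
theoremA C A A-reflections (S₁ , S₂ , S₁⊆S , _ , A⇔) x y = In𝒟-*W A A-reflections closed
  where
    open DescentClasses C using (conj; conj-·; In𝒟-*W)
    -- Members of `S₁` are simple; a member of some C(s) with s in `S₂` has all its conjugates in
    -- the same class, hence in A.
    closed : ∀ {r} → T (A r) → r ∈ S C ⊎ (∀ b → T (A (conj b r)))
    closed {r} Ar with Equivalence.to (A⇔ r) Ar
    ... | inj₁ r∈S₁ = inj₁ (All.lookup S₁⊆S r∈S₁)
    ... | inj₂ (s , s∈S₂ , w , refl) =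
      inj₂ λ b → Equivalence.from (A⇔ _) (inj₂ (s , s∈S₂ , _ , sym (conj-· b w s)))
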